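{- Let $\Sigma$ be a signature and let $\mathcal{I},\mathcal{I}'$ be $\Sigma$-models. If there exists an epimorphism $\mu:\Delta^{\mathcal{I}}\to\Delta^{\mathcal{I}'}$, then for all concept descriptions $C,D\in\mathcal{EC}(\Sigma)$: $$\mathcal{I}\models C\sqsubseteq D\iff\mathcal{I}'\models C\sqsubseteq D.$$
   Context: A signature $\Sigma=(N_C,N_R)$ consists of a set $N_C$ of concept names and a set $N_R$ of role names. The set $\mathcal{EC}(\Sigma)$ of concept descriptions (description logic $\mathcal{ALC}$) is inductively generated by: $\bot,\top$; every $c\in N_C$; $C\sqcup D$, $C\sqcap D$, $C^c$ for $C,D\in\mathcal{EC}(\Sigma)$; $\forall r.C$, $\exists r.C$ for $C\in\mathcal{EC}(\Sigma)$, $r\in N_R$. A $\Sigma$-model $\mathcal{I}$ consists of a non-empty set $\Delta^{\mathcal{I}}$ (the carrier), a subset $c^{\mathcal{I}}\subseteq\Delta^{\mathcal{I}}$ for each $c\in N_C$ and a binary relation $r^{\mathcal{I}}\subseteq\Delta^{\mathcal{I}}\times\Delta^{\mathcal{I}}$ for each $r\in N_R$. The evaluation $C^{\mathcal{I}}\subseteq\Delta^{\mathcal{I}}$ of a concept description is defined by: $\top^{\mathcal{I}}=\Delta^{\mathcal{I}}$, $\bot^{\mathcal{I}}=\emptyset$, concept names are evaluated as given, $\sqcup,\sqcap$ are union and intersection, $(C^c)^{\mathcal{I}}=\Delta^{\mathcal{I}}\setminus C^{\mathcal{I}}$, $(\forall r.C)^{\mathcal{I}}=\{x\mid \forall y,\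 (x,y)\in r^{\mathcal{I}}\Rightarrow y\in C^{\mathcal{I}}\}$, $(\exists r.C)^{\mathcal{I}}=\{x\mid \exists y,\ (x,y)\in r^{\mathcal{I}}\text{ and } y\in C^{\mathcal{I}}\}$. $\mathcal{I}\models C\sqsubseteq D$ means $C^{\mathcal{I}}\subseteq D^{\mathcal{I}}$. A morphism from $\mathcal{I}$ to $\mathcal{I}'$ is a map $\mu:\Delta^{\mathcal{I}}\to\Delta^{\mathcal{I}'}$ such that (1) for all $c\in N_C$, $a\in\Delta^{\mathcal{I}}$: $a\in c^{\mathcal{I}}\Leftrightarrow\mu(a)\in c^{\mathcal{I}'}$; (2) for all $r\in N_R$: (a) $(a,b)\in r^{\mathcal{I}}$ implies $(\mu(a),\mu(b))\in r^{\mathcal{I}'}$; (b) for all $a\in\Delta^{\mathcal{I}}$, $a'\in\Delta^{\mathcal{I}'}$ with $(\mu(a),a')\in r^{\mathcal{I}'}$ there is $b\in\Delta^{\mathcal{I}}$ with $(a,b)\in r^{\mathcal{I}}$ and $\mu(b)=a'$. An epimorphism is a surjective morphism. -}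

module Defs where

open import Data.Product using (∃; _×_)
open import Function.Bundles using (_⇔_)
open import Function.Definitions using (StrictlySurjective)
open import Level using (Level; _⊔_; suc)
open import Relation.Binary.Core using (Rel)
open import Relation.Binary.PropositionalEquality using (_≡_)
open import Relation.Unary using (Pred; _∈_; _⊆_; _∩_; _∪_; ∁)
open import Relation.Unary.Polymorphic using (∅; U)

private
  variable
    a b ℓ ℓ′ : Level

record Signature (a b : Level) : Set (suc (a ⊔ b)) where
  field
    ConceptName : Set a
    RoleName    : Set b

open Signature public

infix  9 _ᶜ
infixr 8 ∀[_]_ ∃[_]_
infixr 7 _⊓ᶜ_
infixr 6 _⊔ᶜ_

data Concept (S : Signature a b) : Set (a ⊔ b) where
  ⊥ᶜ ⊤ᶜ       : Concept S
  name        : ConceptName S → Concept S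
  _⊔ᶜ_ _⊓ᶜ_   : Concept S → Concept S → Concept S
  _ᶜ          : Concept S → Concept S
  ∀[_]_ ∃[_]_ : RoleName S → Concept S → Concept S

-- Carrier and predicates share one level, so that the evaluation of a
-- concept, which quantifies over the carrier, stays at that level.
record Model (S : Signature a b) (ℓ : Level) : Set (a ⊔ b ⊔ suc ℓ) where
  field
    Δ        : Set ℓ
    -- Non-emptiness in its constructive form; morphisms need not preserve
    -- this element.
    nonEmpty : Δ
    conceptᴵ : ConceptName S → Pred Δ ℓ
    roleᴵ    : RoleName S → Rel Δ ℓ

open Model public

module _ {S : Signature a b} where

  ⟦_⟧ : Concept S → (I : Model S ℓ) → Pred (Δ I) ℓ
  ⟦ ⊥ᶜ ⟧       I = ∅
  ⟦ ⊤ᶜ ⟧       I = U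
  ⟦ name c ⟧   I = conceptᴵ I c
  ⟦ C ⊔ᶜ D ⟧   I = ⟦ C ⟧ I ∪ ⟦ D ⟧ I
  ⟦ C ⊓ᶜ D ⟧   I = ⟦ C ⟧ I ∩ ⟦ D ⟧ I
  ⟦ C ᶜ ⟧      I = ∁ (⟦ C ⟧ I)
  ⟦ ∀[ r ] C ⟧ I = λ x → ∀ y → roleᴵ I r x y → y ∈ ⟦ C ⟧ I
  ⟦ ∃[ r ] C ⟧ I = λ x → ∃ λ y → roleᴵ I r x y × y ∈ ⟦ C ⟧ I

  infix 4 _⊨_⊑_

  _⊨_⊑_ : Model S ℓ → Concept S → Concept S → Set ℓ
  I ⊨ C ⊑ D = ⟦ C ⟧ I ⊆ ⟦ D ⟧ I

  record IsMorphism (I : Model S ℓ) (I′ : Model S ℓ′) (μ : Δ I → Δ I′)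
                    : Set (a ⊔ b ⊔ ℓ ⊔ ℓ′) where
    field
      concept : ∀ c x → x ∈ conceptᴵ I c ⇔ μ x ∈ conceptᴵ I′ c
      forth   : ∀ r x y → roleᴵ I r x y → roleᴵ I′ r (μ x) (μ y)
      back    : ∀ r x x′ → roleᴵ I′ r (μ x) x′ →
                ∃ λ y → roleᴵ I r x y × μ y ≡ x′

  record IsEpimorphism (I : Model S ℓ) (I′ : Model S ℓ′) (μ : Δ I → Δ I′)
                       : Set (a ⊔ b ⊔ ℓ ⊔ ℓ′) where
    field
      isMorphism : IsMorphism I I′ μ
      surjective : StrictlySurjective _≡_ μ

{-# OPTIONS --safe #-}
-- A morphism is a bisimulation given by a function: membership in every concept
-- description is both preserved and reflected.  Surjectivity then makes each
-- point of the target an image, so that inclusions transfer both ways.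
module Submission where

open import Defs
open import Data.Product using (∃; _,_)
open import Data.Sum using (inj₁; inj₂)
open import Function.Base using (_∘_)
open import Function.Bundles using (_⇔_; mk⇔; Equivalence)
open import Level using (Level; lift)
open import Relation.Binary.PropositionalEquality using (refl)
open import Relation.Unary using (_∈_)

private
  variable
    a b ℓ ℓ′ : Level

module _ {S : Signature a b} {I : Model S ℓ} {I′ : Model S ℓ′}
         {μ : Δ I → Δ I′} (isMorphism : IsMorphism I I′ μ) where

  open IsMorphism isMorphism

  -- The two directions go by one mutual induction on `C`: complement is contravariant, so each
  -- direction at `C ᶜ` calls the other at `C`.
  preserves : ∀ C {x} → x ∈ ⟦ C ⟧ I → μ x ∈ ⟦ C ⟧ I′
  reflects  : ∀ C {x} → μ x ∈ ⟦ C ⟧ I′ → x ∈ ⟦ C ⟧ I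

  preserves ⊥ᶜ         (lift ())
  preserves ⊤ᶜ         _             = _
  preserves (name c)   p             = Equivalence.to (concept c _) p
  preserves (C ⊔ᶜ D)   (inj₁ p)      = inj₁ (preserves C p)
  preserves (C ⊔ᶜ D)   (inj₂ p)      = inj₂ (preserves D p)
  preserves (C ⊓ᶜ D)   (p , q)       = preserves C p , preserves D q
  preserves (C ᶜ)      p             = p ∘ reflects C
  -- `back` lifts the successor `y′` of `μ x` to a successor of `x`, the only place where `p` says
  -- anything.
  preserves (∀[ r ] C) p y′ rxy′ with back r _ y′ rxy′
  ... | y , rxy , refl               = preserves C (p y rxy)
  preserves (∃[ r ] C) (y , rxy , p) = μ y , forth r _ y rxy , preserves C p

  reflects ⊥ᶜ         (lift ())
  reflects ⊤ᶜ         _        = _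
  reflects (name c)   p        = Equivalence.from (concept c _) p
  reflects (C ⊔ᶜ D)   (inj₁ p) = inj₁ (reflects C p)
  reflects (C ⊔ᶜ D)   (inj₂ p) = inj₂ (reflects D p)
  reflects (C ⊓ᶜ D)   (p , q)  = reflects C p , reflects D q
  reflects (C ᶜ)      p        = p ∘ preserves C
  -- The conditions trade places: `forth` now serves `∀`, and `back` supplies the witness for `∃`.
  reflects (∀[ r ] C) p y rxy  = reflects C (p (μ y) (forth r _ y rxy))
  reflects (∃[ r ] C) (y′ , rxy′ , p) with back r _ y′ rxy′
  ... | y , rxy , refl         = y , rxy , reflects C p

theorem2 : ∀ {a b ℓ ℓ′} (S : Signature a b) (I : Model S ℓ) (I′ : Model S ℓ′) →
    (∃ λ (μ : Δ I → Δ I′) → IsEpimorphism I I′ μ) →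
    ∀ (C D : Concept S) → (I ⊨ C ⊑ D) ⇔ (I′ ⊨ C ⊑ D)
theorem2 S I I′ (μ , epi) C D = mk⇔ to from
  where
  open IsEpimorphism epi

  to : I ⊨ C ⊑ D → I′ ⊨ C ⊑ D
  -- `reflects` speaks only of points `μ x`, so `x′` must first be written as one.
  to C⊑D {x′} p with surjective x′
  ... | x , refl = preserves isMorphism D (C⊑D (reflects isMorphism C p))

  from : I′ ⊨ C ⊑ D → I ⊨ C ⊑ D
  from C⊑D p = reflects isMorphism D (C⊑D (preserves isMorphism C p))
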